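{- Let $G$ be a bipartite graph and let $K:E(G)\to L_n$ be an edge-labeling with permutations from $L_n$. Then $(G,K)$ has no consistent vertex-labeling if and only if $G$ contains a chordless (induced) cycle $C$ such that $(C,K|_{E(C)})$ has no consistent vertex-labeling.
   Context: Labeled graphs: $G$ is a finite simple graph in which each edge is given a fixed orientation; $uv$ denotes the edge oriented from $u$ to $v$. An edge-labeling $K:E(G)\to S_n$ assigns to each edge a permutation of $[n]=\{0,\dots,n-1\}$. A vertex-labeling is a map $k:V(G)\to[n]$. An edge $uv$ with $K(uv)=\pi$ is a contradiction of $k$ if $\pi(k(u))\neq k(v)$. A vertex-labeling is consistent if it has no contradictions. $L_n=\{\pi_0,\dots,\pi_{n-1}\}\subseteq S_n$, where $\pi_i(x)\equiv i-x \pmod n$. Each $\pi_i$ is an involution, so orientation is irrelevant. -}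

module Defs where

open import Data.Bool using (Bool; T)
open import Data.Fin using (Fin; toℕ)
open import Data.Fin.Permutation using (Permutation; Permutation′; permutation; _⟨$⟩ʳ_; _≈_)
open import Data.Fin.Properties using (toℕ-injective; toℕ-fromℕ<; toℕ<n; toℕ≤n)
open import Data.Nat using (ℕ; suc; _+_; _∸_; _%_; NonZero)
open import Data.Nat.DivMod
  using (_mod_; m%n<n; m%n%n≡m%n; m<n⇒m%n≡m; [m+n]%n≡m%n; %-distribˡ-+)
open import Data.Nat.Properties using (+-assoc; +-comm; m∸n+n≡m; m+[n∸m]≡n)
open import Data.Product using (∃-syntax; Σ-syntax)
open import Data.Sum using (_⊎_)
open import Function.Bundles using (_⇔_)
open import Function.Definitions using (Injective)
open import Relation.Binary.PropositionalEquality
  using (_≡_; _≢_; cong; module ≡-Reasoning)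
open import Relation.Nullary using (¬_)

open ≡-Reasoning

-- A finite simple graph whose edges carry a fixed orientation: `T (arc u v)`
-- says that there is an edge oriented from u to v.  Asymmetry excludes loops
-- (u = v) and gives each edge exactly one orientation.
record Graph : Set where
  field
    order : ℕ
    arc   : Fin order → Fin order → Bool
    asym  : ∀ u v → T (arc u v) → ¬ T (arc v u)

  Vertex : Set
  Vertex = Fin order

  record Edge : Set where
    constructor edge
    field
      tail head : Vertex
      isArc     : T (arc tail head)

  Adjacent : Vertex → Vertex → Set
  Adjacent u v = T (arc u v) ⊎ T (arc v u)

open Graph using (order; arc; Vertex; Edge; edge; Adjacent)
open Edge using (tail; head)

Bipartite : Graph → Set
Bipartite G =
  Σ[ side ∈ (Vertex G → Bool) ] (∀ u v → Adjacent G u v → side u ≢ side v)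

EdgeLabeling : Graph → ℕ → Set
EdgeLabeling G n = Edge G → Permutation′ n

VertexLabeling : Graph → ℕ → Set
VertexLabeling G n = Vertex G → Fin n

module _ (G : Graph) {n : ℕ} (K : EdgeLabeling G n) where

  Contradiction : VertexLabeling G n → Edge G → Set
  Contradiction k e = K e ⟨$⟩ʳ k (tail e) ≢ k (head e)

  Consistent : VertexLabeling G n → Set
  Consistent k = ∀ e → ¬ Contradiction k e

  HasConsistentLabeling : Set
  HasConsistentLabeling = ∃[ k ] Consistent k

-- A subgraph of G, presented as a graph with its inclusion map into G; its
-- edges are oriented as in G.
record _⊆_ (C G : Graph) : Set where
  field
    incl      : Vertex C → Vertex G
    injective : Injective _≡_ _≡_ incl
    arc⁺      : ∀ u v → T (arc C u v) → T (arc G (incl u) (incl v))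

  inclᴱ : Edge C → Edge G
  inclᴱ (edge u v a) = edge (incl u) (incl v) (arc⁺ u v a)

open _⊆_ using (incl; inclᴱ)

restrict : ∀ {C G n} → C ⊆ G → EdgeLabeling G n → EdgeLabeling C n
restrict ι K e = K (inclᴱ ι e)

Chordless : ∀ {C G} → C ⊆ G → Set
Chordless {C} {G} ι =
  ∀ u v → Adjacent G (incl ι u) (incl ι v) → Adjacent C u v

Next : ∀ {l} .{{_ : NonZero l}} → Fin l → Fin l → Set
Next {l} i j = toℕ j ≡ suc (toℕ i) % l

-- The vertices can be listed cyclically, without repetition, so that the edges
-- are exactly the pairs of consecutive vertices.  The length is 3 + m since
-- the graphs are simple.
IsCycle : Graph → Set
IsCycle C =
  ∃[ m ] Σ[ σ ∈ Permutation (3 + m) (order C) ]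
    (∀ i j → Adjacent C (σ ⟨$⟩ʳ i) (σ ⟨$⟩ʳ j) ⇔ (Next i j ⊎ Next j i))

module _ {n : ℕ} .{{_ : NonZero n}} where

  -- i - x mod n; the summand n keeps the truncated subtraction exact.
  reflect : Fin n → Fin n → Fin n
  reflect i x = (toℕ i + (n ∸ toℕ x)) mod n

  private
    toℕ-reflect : ∀ i x → toℕ (reflect i x) ≡ (toℕ i + (n ∸ toℕ x)) % n
    toℕ-reflect i x = toℕ-fromℕ< (m%n<n (toℕ i + (n ∸ toℕ x)) n)

    %-absorb : ∀ a b → (a % n + b) % n ≡ (a + b) % n
    %-absorb a b = begin
      (a % n + b) % n          ≡⟨ %-distribˡ-+ (a % n) b n ⟩
      (a % n % n + b % n) % n  ≡⟨ cong (λ t → (t + b % n) % n) (m%n%n≡m%n a n) ⟩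
      (a % n + b % n) % n      ≡⟨ %-distribˡ-+ a b n ⟨
      (a + b) % n              ∎

  reflect-sum : ∀ i x → (toℕ (reflect i x) + toℕ x) % n ≡ toℕ i
  reflect-sum i x = begin
    (toℕ (reflect i x) + toℕ x) % n
      ≡⟨ cong (λ t → (t + toℕ x) % n) (toℕ-reflect i x) ⟩
    ((toℕ i + (n ∸ toℕ x)) % n + toℕ x) % n
      ≡⟨ %-absorb (toℕ i + (n ∸ toℕ x)) (toℕ x) ⟩
    (toℕ i + (n ∸ toℕ x) + toℕ x) % n
      ≡⟨ cong (_% n) (+-assoc (toℕ i) (n ∸ toℕ x) (toℕ x)) ⟩
    (toℕ i + (n ∸ toℕ x + toℕ x)) % n
      ≡⟨ cong (λ t → (toℕ i + t) % n) (m∸n+n≡m (toℕ≤n x)) ⟩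
    (toℕ i + n) % n
      ≡⟨ [m+n]%n≡m%n (toℕ i) n ⟩
    toℕ i % n
      ≡⟨ m<n⇒m%n≡m (toℕ<n i) ⟩
    toℕ i ∎

  reflect-involutive : ∀ i x → reflect i (reflect i x) ≡ x
  reflect-involutive i x = toℕ-injective (begin
    toℕ (reflect i y)
      ≡⟨ toℕ-reflect i y ⟩
    (toℕ i + (n ∸ toℕ y)) % n
      ≡⟨ cong (λ t → (t + (n ∸ toℕ y)) % n) (reflect-sum i x) ⟨
    ((toℕ y + toℕ x) % n + (n ∸ toℕ y)) % n
      ≡⟨ %-absorb (toℕ y + toℕ x) (n ∸ toℕ y) ⟩
    (toℕ y + toℕ x + (n ∸ toℕ y)) % n
      ≡⟨ cong (λ t → (t + (n ∸ toℕ y)) % n) (+-comm (toℕ y) (toℕ x)) ⟩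
    (toℕ x + toℕ y + (n ∸ toℕ y)) % n
      ≡⟨ cong (_% n) (+-assoc (toℕ x) (toℕ y) (n ∸ toℕ y)) ⟩
    (toℕ x + (toℕ y + (n ∸ toℕ y))) % n
      ≡⟨ cong (λ t → (toℕ x + t) % n) (m+[n∸m]≡n (toℕ≤n y)) ⟩
    (toℕ x + n) % n
      ≡⟨ [m+n]%n≡m%n (toℕ x) n ⟩
    toℕ x % n
      ≡⟨ m<n⇒m%n≡m (toℕ<n x) ⟩
    toℕ x ∎)
    where
    y : Fin n
    y = reflect i x

  π : Fin n → Permutation′ n
  π i = permutation (reflect i) (reflect i) (reflect-involutive i) (reflect-involutive i)

  -- Membership in L_n.  Permutations are compared as functions (pointwise),
  -- not as records containing proofs.
  InL : Permutation′ n → Set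
  InL ρ = ∃[ i ] ρ ≈ π i

{-# OPTIONS --safe #-}

-- Composing the labels along a walk gives a permutation of Fin n.  Fix, for every
-- component, a root and walks from it: transporting a value from the roots gives a
-- consistent labeling unless some closed walk acts nontrivially.  A coincidence of
-- vertices or a chord cuts such a walk into two shorter closed walks, one of which
-- again acts nontrivially, so one that cannot be shortened traverses an induced
-- cycle.  Since G is bipartite, closed walks act as translations of ℤ/n; a consistent
-- labeling of the cycle would provide a fixed point, forcing the action to be trivial.
module Submission where

open import Defs
open import Data.Bool using (Bool; T; T?)
open import Data.Bool.Properties using (T-irrelevant; ¬-not)
open import Data.Empty using (⊥-elim)
open import Data.Fin using (Fin; zero; toℕ; fromℕ<; _≟_)
open import Data.Fin.Permutation using (_⟨$⟩ʳ_; _⟨$⟩ˡ_; inverseˡ; inverseʳ) renaming (id to idᵖ)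
open import Data.Fin.Properties using (any?; toℕ-injective; toℕ<n; toℕ-fromℕ<)
open import Data.List using (List; []; _∷_; allFin; cartesianProduct)
open import Data.List.Membership.Propositional using (_∈_)
open import Data.List.Membership.Propositional.Properties using (∈-allFin; ∈-cartesianProduct⁺)
open import Data.List.Relation.Unary.Any using (here; there)
open import Data.Nat
  using (ℕ; zero; suc; pred; NonZero; _+_; _*_; _%_; _≤_; _<_; z≤n; s≤s; _<?_; _≤?_)
open import Data.Nat.DivMod using (%-distribˡ-+; [m+kn]%n≡m%n; m<n⇒m%n≡m; n%n≡0)
open import Data.Nat.Induction using (<-wellFounded; Acc; acc)
open import Data.Nat.Properties
  using ( +-comm; +-suc; +-identityʳ; +-monoˡ-<; +-monoʳ-<; m≤m+n; m≤n+m; suc-pred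
        ; ≤-reflexive; ≤-trans; ≤-antisym; ≤-<-trans; <-irrefl; <⇒≤; ≮⇒≥; <-cmp
        ; m≤n⇒∃[o]m+o≡n; m≤n⇒m<n∨m≡n; anyUpTo?; module ≤-Reasoning)
open import Data.Nat.Tactic.RingSolver using (solve-∀)
open import Data.Product using (Σ-syntax; ∃-syntax; _×_; _,_; proj₁; proj₂)
open import Data.Sum using (_⊎_; inj₁; inj₂; swap)
open import Function.Base using (_∘_; id)
open import Function.Bundles using (_⇔_; mk⇔)
open import Relation.Binary.Construct.Closure.ReflexiveTransitive using (Star; ε; _◅_; _◅◅_)
open import Relation.Binary.Definitions using (tri<; tri≈; tri>)
open import Relation.Binary.PropositionalEquality
  using (_≡_; _≢_; refl; sym; trans; cong; cong₂; subst; module ≡-Reasoning)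
open import Relation.Nullary using (¬_; Dec; yes; no)
open import Relation.Nullary.Decidable using (_×-dec_; _⊎-dec_; ¬?; decidable-stable; map′)

open Graph using (order; arc; asym; Vertex; edge; Adjacent)
open _⊆_ using (incl; inclᴱ)

-- Congruence of naturals modulo `n`.

module _ {n : ℕ} .{{_ : NonZero n}} where

  infix 4 _≡ₙ_

  _≡ₙ_ : ℕ → ℕ → Set
  a ≡ₙ b = a % n ≡ b % n

  +-congₙ : ∀ {a b c d} → a ≡ₙ b → c ≡ₙ d → a + c ≡ₙ b + d
  +-congₙ {a} {b} {c} {d} p q = begin
    (a + c) % n          ≡⟨ %-distribˡ-+ a c n ⟩
    (a % n + c % n) % n  ≡⟨ cong₂ (λ s t → (s + t) % n) p q ⟩
    (b % n + d % n) % n  ≡⟨ %-distribˡ-+ b d n ⟨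
    (b + d) % n          ∎
    where open ≡-Reasoning

  -- Adding `pred n * c` completes the summand `c` to the multiple `c * n`, so cancellation works
  -- without subtraction.
  +-cancelʳₙ : ∀ {a b} c → a + c ≡ₙ b + c → a ≡ₙ b
  +-cancelʳₙ {a} {b} c p = begin
    a % n                       ≡⟨ collapse a ⟨
    (a + c + pred n * c) % n    ≡⟨ +-congₙ p refl ⟩
    (b + c + pred n * c) % n    ≡⟨ collapse b ⟩
    b % n                       ∎
    where
    open ≡-Reasoning

    regroup : ∀ a c m → a + c + m * c ≡ a + c * suc m
    regroup = solve-∀

    collapse : ∀ a → (a + c + pred n * c) % n ≡ a % n
    collapse a = begin
      (a + c + pred n * c) % n    ≡⟨ cong (_% n) (regroup a c (pred n)) ⟩
      (a + c * suc (pred n)) % n  ≡⟨ cong (λ m → (a + c * m) % n) (suc-pred n) ⟩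
      (a + c * n) % n             ≡⟨ [m+kn]%n≡m%n a c n ⟩
      a % n                       ∎

  toℕ-injectiveₙ : ∀ {x y : Fin n} → toℕ x ≡ₙ toℕ y → x ≡ y
  toℕ-injectiveₙ {x} {y} p = toℕ-injective (begin
    toℕ x      ≡⟨ m<n⇒m%n≡m (toℕ<n x) ⟨
    toℕ x % n  ≡⟨ p ⟩
    toℕ y % n  ≡⟨ m<n⇒m%n≡m (toℕ<n y) ⟩
    toℕ y      ∎)
    where open ≡-Reasoning

  origin : Fin n
  origin = fromℕ< (subst (0 <_) (suc-pred n) (s≤s z≤n))

-- Walks, shortcuts in walks, and spanning forests.

module Walks (G : Graph) where

  Walk : Vertex G → Vertex G → Set
  Walk = Star (Adjacent G)

  length : ∀ {u v} → Walk u v → ℕ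
  length ε       = 0
  length (_ ◅ w) = suc (length w)

  reverse : ∀ {u v} → Walk u v → Walk v u
  reverse ε       = ε
  reverse (a ◅ w) = reverse w ◅◅ swap a ◅ ε

  length-◅◅ : ∀ {u v z} (p : Walk u v) (q : Walk v z) → length (p ◅◅ q) ≡ length p + length q
  length-◅◅ ε       q = refl
  length-◅◅ (_ ◅ p) q = cong suc (length-◅◅ p q)

  length-reverse : ∀ {u v} (p : Walk u v) → length (reverse p) ≡ length p
  length-reverse ε       = refl
  length-reverse (a ◅ p) = begin
    length (reverse p ◅◅ swap a ◅ ε)  ≡⟨ length-◅◅ (reverse p) (swap a ◅ ε) ⟩
    length (reverse p) + 1            ≡⟨ +-comm (length (reverse p)) 1 ⟩
    suc (length (reverse p))          ≡⟨ cong suc (length-reverse p) ⟩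
    suc (length p)                    ∎
    where open ≡-Reasoning

  infixl 8 _!_

  -- Beyond its length a walk stays at its endpoint.
  _!_ : ∀ {u v} → Walk u v → ℕ → Vertex G
  _!_ {u} w       zero    = u
  _!_ {u} ε       (suc i) = u
  _!_     (_ ◅ w) (suc i) = w ! i

  take : ∀ {u v} (w : Walk u v) i → Walk u (w ! i)
  take w       zero    = ε
  take ε       (suc i) = ε
  take (a ◅ w) (suc i) = a ◅ take w i

  drop : ∀ {u v} (w : Walk u v) i → Walk (w ! i) v
  drop w       zero    = w
  drop ε       (suc i) = ε
  drop (a ◅ w) (suc i) = drop w i

  drop-! : ∀ {u v} (w : Walk u v) i d → drop w i ! d ≡ w ! (i + d)
  drop-! w       zero    d       = refl
  drop-! ε       (suc i) zero    = refl
  drop-! ε       (suc i) (suc d) = refl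
  drop-! (_ ◅ w) (suc i) d       = drop-! w i d

  !-beyond : ∀ {u v} (w : Walk u v) {i} → length w ≤ i → w ! i ≡ v
  !-beyond ε       {zero}  _         = refl
  !-beyond ε       {suc i} _         = refl
  !-beyond (_ ◅ w) {suc i} (s≤s l≤i) = !-beyond w l≤i

  !-adjacent : ∀ {u v} (w : Walk u v) {i} → i < length w → Adjacent G (w ! i) (w ! suc i)
  !-adjacent (a ◅ w) {zero}  _         = a
  !-adjacent (_ ◅ w) {suc i} (s≤s i<l) = !-adjacent w i<l

  length-take : ∀ {u v} (w : Walk u v) {i} → i ≤ length w → length (take w i) ≡ i
  length-take w       {zero}  _         = refl
  length-take (_ ◅ w) {suc i} (s≤s i≤l) = cong suc (length-take w i≤l)

  length-take-drop : ∀ {u v} (w : Walk u v) i → length (take w i) + length (drop w i) ≡ length w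
  length-take-drop w       zero    = refl
  length-take-drop ε       (suc i) = refl
  length-take-drop (_ ◅ w) (suc i) = cong suc (length-take-drop w i)

  ≤-drop : ∀ {u v} (w : Walk u v) i {d} → i + d ≤ length w → d ≤ length (drop w i)
  ≤-drop w       zero    d≤l         = d≤l
  ≤-drop (_ ◅ w) (suc i) (s≤s i+d≤l) = ≤-drop w i i+d≤l

  loopless : ∀ {u v} → u ≡ v → ¬ Adjacent G u v
  loopless refl (inj₁ a) = asym G _ _ a a
  loopless refl (inj₂ a) = asym G _ _ a a

  -- Asymmetry gives each edge a single orientation. Hence a walk that goes to a neighbour and
  -- straight back uses the same label both ways.
  Adjacent-irrelevant : ∀ {u v} (a b : Adjacent G u v) → a ≡ b
  Adjacent-irrelevant (inj₁ a) (inj₁ b) = cong inj₁ (T-irrelevant a b)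
  Adjacent-irrelevant (inj₁ a) (inj₂ b) = ⊥-elim (asym G _ _ a b)
  Adjacent-irrelevant (inj₂ a) (inj₁ b) = ⊥-elim (asym G _ _ a b)
  Adjacent-irrelevant (inj₂ a) (inj₂ b) = cong inj₂ (T-irrelevant a b)

  adjacent? : ∀ u v → Dec (Adjacent G u v)
  adjacent? u v = T? (arc G u v) ⊎-dec T? (arc G v u)

  -- The segment of length `d` from position `i` can be bypassed by a walk of length 0 (repeated
  -- vertex) or 1 (chord). If `q` is that length, the bounds are `q < d` and `q + d < length w`:
  -- both closed walks cut out are then shorter than `w`. The far end is written `drop w i ! d` to
  -- fit the type of `take (drop w i) d`.
  Shortcut : ∀ {u v} → Walk u v → ℕ → ℕ → Set
  Shortcut w i d = i + d ≤ length w ×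
    (0 < d × d < length w × w ! i ≡ drop w i ! d ⊎
     1 < d × suc d < length w × Adjacent G (w ! i) (drop w i ! d))

  shortcut? : ∀ {u v} (w : Walk u v) i d → Dec (Shortcut w i d)
  shortcut? w i d = (i + d ≤? length w) ×-dec
    ((0 <? d) ×-dec (d <? length w) ×-dec (w ! i ≟ drop w i ! d) ⊎-dec
     (1 <? d) ×-dec (suc d <? length w) ×-dec adjacent? (w ! i) (drop w i ! d))

  Irreducible : ∀ {u v} → Walk u v → Set
  Irreducible w = ∀ i d → ¬ Shortcut w i d

  irreducible? : ∀ {u v} (w : Walk u v) → Irreducible w ⊎ ∃[ i ] ∃[ d ] Shortcut w i d
  irreducible? w
    with anyUpTo? (λ i → anyUpTo? (shortcut? w i) (suc (length w))) (suc (length w))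
  ... | yes (i , _ , d , _ , s) = inj₂ (i , d , s)
  ... | no none = inj₁ λ i d s → none
        (i , s≤s (≤-trans (m≤m+n i d) (proj₁ s)) , d , s≤s (≤-trans (m≤n+m d i) (proj₁ s)) , s)

  -- Components of the graph formed by the edges among the pairs treated so far. `joins` assumes
  -- adjacency, so `es` may also list non-adjacent pairs.
  record Forest (es : List (Vertex G × Vertex G)) : Set where
    field
      root  : Vertex G → Vertex G
      path  : ∀ v → Walk (root v) v
      joins : ∀ {u v} → (u , v) ∈ es → Adjacent G u v → root u ≡ root v

  open Forest

  -- The class of `v` is rerooted at the root of `u`; the new root reaches the old one through `u`,
  -- the edge `a`, and the path of `v` reversed.
  merge : ∀ {es} (F : Forest es) {u v} → Adjacent G u v → Forest ((u , v) ∷ es)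
  merge F {u} {v} a = record
    { root  = redirect ∘ root F
    ; path  = λ w → link (root F w) ◅◅ path F w
    ; joins = λ { (here refl)  _ → joined
                ; (there e∈es) b → cong redirect (joins F e∈es b) }
    }
    where
    redirect : Vertex G → Vertex G
    redirect r with r ≟ root F v
    ... | yes _ = root F u
    ... | no  _ = r

    link : ∀ r → Walk (redirect r) r
    link r with r ≟ root F v
    ... | yes refl = path F u ◅◅ a ◅ reverse (path F v)
    ... | no  _    = ε

    joined : redirect (root F u) ≡ redirect (root F v)
    joined with root F u ≟ root F v | root F v ≟ root F v
    ... | yes _ | yes _ = refl
    ... | no  _ | yes _ = refl
    ... | _     | no ≢v = ⊥-elim (≢v refl)

  forest : ∀ es → Forest es
  forest []             = record { root = id ; path = λ _ → ε ; joins = λ () }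
  forest ((u , v) ∷ es) with adjacent? u v
  ... | yes a = merge (forest es) a
  ... | no ¬a = record
    { root  = root (forest es)
    ; path  = path (forest es)
    ; joins = λ { (here refl)  a → ⊥-elim (¬a a)
                ; (there e∈es) a → joins (forest es) e∈es a }
    }

  spanningForest : Σ[ r ∈ (Vertex G → Vertex G) ]
    (∀ v → Walk (r v) v) × (∀ {u v} → Adjacent G u v → r u ≡ r v)
  spanningForest = root F , path F , joins F (∈-cartesianProduct⁺ (∈-allFin _) (∈-allFin _))
    where F = forest (cartesianProduct (allFin (order G)) (allFin (order G)))

-- An irreducible closed walk traverses an induced cycle.

module InducedCycle (G : Graph) where
  open Walks G

  -- Arcs are pulled back along `f`, which makes chordlessness of the inclusion the identity
  -- function.
  induced : ∀ {l} → (Fin l → Vertex G) → Graph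
  induced {l} f = record
    { order = l
    ; arc   = λ i j → arc G (f i) (f j)
    ; asym  = λ i j → asym G (f i) (f j)
    }

  module _ {u} (w : Walk u u) (irr : Irreducible w) where

    distinct : ∀ {i j} → i < j → j < length w → w ! i ≢ w ! j
    distinct {i} i<j j<l eq with m≤n⇒∃[o]m+o≡n (<⇒≤ i<j)
    ... | zero  , refl = ⊥-elim (<-irrefl (sym (+-identityʳ i)) i<j)
    ... | suc d , refl = irr i (suc d)
          (<⇒≤ j<l , inj₁ (s≤s z≤n , ≤-<-trans (m≤n+m (suc d) i) j<l , trans eq (sym (drop-! w i (suc d)))))

    chord-free : ∀ {i j} → i < j → j < length w → Adjacent G (w ! i) (w ! j) →
      j ≡ suc i ⊎ (i ≡ 0 × suc j ≡ length w)
    chord-free {i} i<j j<l a with m≤n⇒∃[o]m+o≡n i<j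
    ... | zero , refl = inj₁ (+-identityʳ _)
    -- The gap `j - i` is `d + 2`. If `d + 3 < length w`, the chord is a shortcut. Otherwise
    -- `length w` is at most `d + 3`, while `j = i + d + 2` is below it; this forces `i` to be 0 and
    -- `j` to be the last position.
    ... | suc d , refl with suc (suc (suc d)) <? length w
    ...   | yes short = ⊥-elim (irr i (suc (suc d))
              ( subst (_≤ length w) (sym i+d) (<⇒≤ j<l)
              , inj₂ (s≤s (s≤s z≤n) , short , subst (Adjacent G (w ! i)) (sym w!i+d) a)))
      where
      i+d : i + suc (suc d) ≡ suc i + suc d
      i+d = +-suc i (suc d)

      w!i+d : drop w i ! suc (suc d) ≡ w ! (suc i + suc d)
      w!i+d = trans (drop-! w i (suc (suc d))) (cong (w !_) i+d)
    ...   | no ¬short with i | j<l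
    ...     | zero  | j<l′ = inj₂ (refl , ≤-antisym j<l′ (≮⇒≥ ¬short))
    ...     | suc i | j<l′ = ⊥-elim (¬short (≤-trans (s≤s (s≤s (s≤s (m≤n+m (suc d) i)))) j<l′))

    module _ {m} (len : length w ≡ 3 + m) where

      private
        <length : ∀ (i : Fin (3 + m)) → toℕ i < length w
        <length i = subst (toℕ i <_) (sym len) (toℕ<n i)

      vertex : Fin (3 + m) → Vertex G
      vertex i = w ! toℕ i

      vertex-injective : ∀ {i j} → vertex i ≡ vertex j → i ≡ j
      vertex-injective {i} {j} eq with <-cmp (toℕ i) (toℕ j)
      ... | tri< i<j _ _ = ⊥-elim (distinct i<j (<length j) eq)
      ... | tri≈ _ i≡j _ = toℕ-injective i≡j
      ... | tri> _ _ j<i = ⊥-elim (distinct j<i (<length i) (sym eq))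

      cycle : Graph
      cycle = induced vertex

      cycle⊆ : cycle ⊆ G
      cycle⊆ = record { incl = vertex ; injective = vertex-injective ; arc⁺ = λ _ _ a → a }

      private
        consecutive : ∀ {i j : Fin (3 + m)} → toℕ i < toℕ j → Adjacent G (vertex i) (vertex j) →
          Next i j ⊎ Next j i
        consecutive {i} {j} i<j a with chord-free i<j (<length j) a
        ... | inj₁ j≡1+i = inj₁ (trans j≡1+i
                (sym (m<n⇒m%n≡m (subst (_< 3 + m) j≡1+i (toℕ<n j)))))
        ... | inj₂ (i≡0 , 1+j≡l) = inj₂ (trans i≡0
                (sym (trans (cong (_% (3 + m)) (trans 1+j≡l len)) (n%n≡0 (3 + m)))))

        next⇒adjacent : ∀ {i j : Fin (3 + m)} → Next i j → Adjacent G (vertex i) (vertex j)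
        next⇒adjacent {i} {j} next = subst (Adjacent G (vertex i)) w!1+i≡ (!-adjacent w (<length i))
          where
          w!1+i≡ : w ! suc (toℕ i) ≡ vertex j
          w!1+i≡ with m≤n⇒m<n∨m≡n (toℕ<n i)
          ... | inj₁ 1+i<l = cong (w !_) (sym (trans next (m<n⇒m%n≡m 1+i<l)))
          -- After the last position comes the endpoint of the closed walk, which is again its
          -- vertex at position 0.
          ... | inj₂ 1+i≡l = trans (!-beyond w (≤-reflexive (trans len (sym 1+i≡l))))
                  (cong (w !_) (sym (trans next (trans (cong (_% (3 + m)) 1+i≡l) (n%n≡0 (3 + m))))))

        adjacent⇒next : ∀ {i j : Fin (3 + m)} → Adjacent G (vertex i) (vertex j) → Next i j ⊎ Next j i
        adjacent⇒next {i} {j} a with <-cmp (toℕ i) (toℕ j)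
        ... | tri< i<j _ _ = consecutive i<j a
        ... | tri≈ _ i≡j _ = ⊥-elim (loopless (cong (w !_) i≡j) a)
        ... | tri> _ _ j<i = swap (consecutive j<i (swap a))

      cycle-isCycle : IsCycle cycle
      -- The identity permutation serves, since the vertices are already indexed in the order of the
      -- walk.
      cycle-isCycle = m , idᵖ , λ i j →
        mk⇔ (adjacent⇒next {i} {j})
          λ { (inj₁ p) → next⇒adjacent {i} {j} p ; (inj₂ p) → swap (next⇒adjacent {j} {i} p) }

      on-cycle : ∀ i → ∃[ j ] vertex j ≡ w ! i
      on-cycle i with i <? 3 + m
      ... | yes i<l = fromℕ< i<l , cong (w !_) (toℕ-fromℕ< i<l)
      ... | no  i≮l = zero , sym (!-beyond w (subst (_≤ i) (sym len) (≮⇒≥ i≮l)))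

-- The action of walks on labels.

module Action (G : Graph) {n : ℕ} (K : EdgeLabeling G n) where
  open Walks G
  open InducedCycle G

  step : ∀ {u v} → Adjacent G u v → Fin n → Fin n
  step (inj₁ a) x = K (edge _ _ a) ⟨$⟩ʳ x
  step (inj₂ a) x = K (edge _ _ a) ⟨$⟩ˡ x

  act : ∀ {u v} → Walk u v → Fin n → Fin n
  act ε       x = x
  act (a ◅ w) x = act w (step a x)

  step-swap : ∀ {u v} (a : Adjacent G u v) x → step (swap a) (step a x) ≡ x
  step-swap (inj₁ a) x = inverseˡ (K (edge _ _ a))
  step-swap (inj₂ a) x = inverseʳ (K (edge _ _ a))

  step-swap′ : ∀ {u v} (a : Adjacent G u v) x → step a (step (swap a) x) ≡ x
  step-swap′ (inj₁ a) x = inverseʳ (K (edge _ _ a))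
  step-swap′ (inj₂ a) x = inverseˡ (K (edge _ _ a))

  act-◅◅ : ∀ {u v z} (p : Walk u v) (q : Walk v z) x → act (p ◅◅ q) x ≡ act q (act p x)
  act-◅◅ ε       q x = refl
  act-◅◅ (a ◅ p) q x = act-◅◅ p q (step a x)

  act-reverse : ∀ {u v} (p : Walk u v) x → act p (act (reverse p) x) ≡ x
  act-reverse ε       x = refl
  act-reverse (a ◅ p) x = begin
    act p (step a (act (reverse p ◅◅ swap a ◅ ε) x))    ≡⟨ cong (act p ∘ step a) (act-◅◅ (reverse p) (swap a ◅ ε) x) ⟩
    act p (step a (step (swap a) (act (reverse p) x)))  ≡⟨ cong (act p) (step-swap′ a _) ⟩
    act p (act (reverse p) x)                           ≡⟨ act-reverse p x ⟩
    x                                                   ∎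
    where open ≡-Reasoning

  act-take-drop : ∀ {u v} (w : Walk u v) i x → act (drop w i) (act (take w i) x) ≡ act w x
  act-take-drop w       zero    x = refl
  act-take-drop ε       (suc i) x = refl
  act-take-drop (a ◅ w) (suc i) x = act-take-drop w i (step a x)

  Bad : ∀ {u} → Walk u u → Set
  Bad w = ∃[ x ] act w x ≢ x

  bad? : ∀ {u} (w : Walk u u) → Dec (Bad w)
  bad? w = any? λ x → ¬? (act w x ≟ x)

  -- A segment b of w and a short walk e between its ends form a theta: if b e⁻¹
  -- acts trivially then b may be replaced by e without changing the action of w.
  detour : ∀ {u} (w : Walk u u) i d (e : Walk (w ! i) (drop w i ! d)) → i + d ≤ length w →
    length e < d → length e + d < length w → Bad w →
    ∃[ z ] Σ[ w′ ∈ Walk z z ] (Bad w′ × length w′ < length w)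
  detour w i d e i+d≤l e<d e+d<l (x , wx≢x) with bad? (take (drop w i) d ◅◅ reverse e)
  -- The closed walk `b e⁻¹` has length `length e + d`, so the second bound makes it shorter than
  -- `w`; the first bound serves the replacement in the other case.
  ... | yes bad = _ , _ , bad , subst (_< length w) (sym len) e+d<l
    where
    open ≡-Reasoning
    b = take (drop w i) d

    len : length (b ◅◅ reverse e) ≡ length e + d
    len = begin
      length (b ◅◅ reverse e)        ≡⟨ length-◅◅ b (reverse e) ⟩
      length b + length (reverse e)  ≡⟨ cong₂ _+_ (length-take (drop w i) (≤-drop w i i+d≤l)) (length-reverse e) ⟩
      d + length e                   ≡⟨ +-comm d (length e) ⟩
      length e + d                   ∎
  ... | no ¬bad = _ , a ◅◅ e ◅◅ c , (x , λ eq → wx≢x (trans (sym same) eq)) , shorter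
    where
    a = take w i
    b = take (drop w i) d
    c = drop (drop w i) d

    e≗b : ∀ y → act e y ≡ act b y
    e≗b y = begin
      act e y                            ≡⟨ cong (act e) (decidable-stable (_ ≟ _) (λ ≢y → ¬bad (y , ≢y))) ⟨
      act e (act (b ◅◅ reverse e) y)     ≡⟨ cong (act e) (act-◅◅ b (reverse e) y) ⟩
      act e (act (reverse e) (act b y))  ≡⟨ act-reverse e (act b y) ⟩
      act b y                            ∎
      where open ≡-Reasoning

    same : act (a ◅◅ e ◅◅ c) x ≡ act w x
    same = begin
      act (a ◅◅ e ◅◅ c) x        ≡⟨ act-◅◅ a (e ◅◅ c) x ⟩
      act (e ◅◅ c) (act a x)     ≡⟨ act-◅◅ e c (act a x) ⟩
      act c (act e (act a x))    ≡⟨ cong (act c) (e≗b (act a x)) ⟩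
      act c (act b (act a x))    ≡⟨ act-take-drop (drop w i) d (act a x) ⟩
      act (drop w i) (act a x)   ≡⟨ act-take-drop w i x ⟩
      act w x                    ∎
      where open ≡-Reasoning

    shorter : length (a ◅◅ e ◅◅ c) < length w
    shorter = begin-strict
      length (a ◅◅ e ◅◅ c)               ≡⟨ length-◅◅ a (e ◅◅ c) ⟩
      length a + length (e ◅◅ c)         ≡⟨ cong (length a +_) (length-◅◅ e c) ⟩
      length a + (length e + length c)   <⟨ +-monoʳ-< (length a) (+-monoˡ-< (length c) e<d) ⟩
      length a + (d + length c)          ≡⟨ cong (λ t → length a + (t + length c)) (length-take (drop w i) (≤-drop w i i+d≤l)) ⟨
      length a + (length b + length c)   ≡⟨ cong (length a +_) (length-take-drop (drop w i) d) ⟩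
      length a + length (drop w i)       ≡⟨ length-take-drop w i ⟩
      length w                           ∎
      where open ≤-Reasoning

  shorten : ∀ {u} (w : Walk u u) i d → Shortcut w i d → Bad w →
    ∃[ z ] Σ[ w′ ∈ Walk z z ] (Bad w′ × length w′ < length w)
  shorten w i d (i+d≤l , inj₁ (0<d , d<l , eq)) =
    detour w i d (proj₁ (trivial eq)) i+d≤l
      (subst (_< d) (sym (proj₂ (trivial eq))) 0<d)
      (subst (λ q → q + d < length w) (sym (proj₂ (trivial eq))) d<l)
    where
    -- Stated for variable endpoints so that the equation can be matched with `refl`, which `w ! i`
    -- and `drop w i ! d` would obstruct.
    trivial : ∀ {u v} → u ≡ v → Σ[ e ∈ Walk u v ] length e ≡ 0
    trivial refl = ε , refl
  shorten w i d (i+d≤l , inj₂ (1<d , 1+d<l , a)) = detour w i d (a ◅ ε) i+d≤l 1<d 1+d<l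

  irreducible-bad : ∀ {u} (w : Walk u u) → Acc _<_ (length w) → Bad w →
    ∃[ z ] Σ[ w′ ∈ Walk z z ] (Bad w′ × Irreducible w′)
  irreducible-bad w (acc rec) bad with irreducible? w
  ... | inj₁ irr         = _ , w , bad , irr
  ... | inj₂ (i , d , s) with shorten w i d s bad
  ...   | _ , w′ , bad′ , w′<w = irreducible-bad w′ (rec w′<w) bad′

  -- The empty walk acts trivially, length 1 would be a loop, and length 2 retraces one edge, where
  -- the label meets its inverse.
  bad-long : ∀ {u} (w : Walk u u) → Bad w → ∃[ m ] length w ≡ 3 + m
  bad-long ε               (x , ≢x) = ⊥-elim (≢x refl)
  bad-long (a ◅ ε)         _        = ⊥-elim (loopless refl a)
  bad-long (a ◅ b ◅ ε)     (x , ≢x) = ⊥-elim (≢x (begin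
    step b (step a x)         ≡⟨ cong (λ c → step c (step a x)) (Adjacent-irrelevant b (swap a)) ⟩
    step (swap a) (step a x)  ≡⟨ step-swap a x ⟩
    x                         ∎))
    where open ≡-Reasoning
  bad-long (_ ◅ _ ◅ _ ◅ w) _        = length w , refl

  -- Every root gets the value `x₀`, transported along the forest. If the result fails on an arc
  -- from `u` to `v`, the closed walk through the path to `u`, the arc and the reversed path to `v`
  -- moves `x₀`.
  consistent-or-bad : Fin n → HasConsistentLabeling G K ⊎ ∃[ u ] Σ[ w ∈ Walk u u ] Bad w
  consistent-or-bad x₀
    with spanningForest
  ... | root , path , joins
    with any? (λ u → any? (λ v → contradiction? u v))
    where
    label : Vertex G → Fin n
    label v = act (path v) x₀

    contradiction? : ∀ u v → Dec (Σ[ a ∈ T (arc G u v) ] K (edge u v a) ⟨$⟩ʳ label u ≢ label v)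
    contradiction? u v with T? (arc G u v)
    ... | no ¬a = no λ (a , _) → ¬a a
    ... | yes a = map′ (a ,_)
            (λ (b , ≢v) → subst (λ c → K (edge u v c) ⟨$⟩ʳ label u ≢ label v) (T-irrelevant b a) ≢v)
            (¬? (K (edge u v a) ⟨$⟩ʳ label u ≟ label v))
  ... | no none = inj₁ ((λ v → act (path v) x₀) , λ (edge u v a) ≢v → none (u , v , a , ≢v))
  ... | yes (u , v , a , ≢v) = inj₂ (root u , close (joins (inj₁ a)) (path u) (path v) ≢v)
    where
    close : ∀ {r s} → r ≡ s → (p : Walk r u) (q : Walk s v) →
      step (inj₁ a) (act p x₀) ≢ act q x₀ → Σ[ w ∈ Walk r r ] Bad w
    close refl p q ≢q = p ◅◅ inj₁ a ◅ reverse q , x₀ , λ eq → ≢q (begin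
      step (inj₁ a) (act p x₀)                                ≡⟨ act-reverse q _ ⟨
      act q (act (reverse q) (step (inj₁ a) (act p x₀)))      ≡⟨ cong (act q) (act-◅◅ p (inj₁ a ◅ reverse q) x₀) ⟨
      act q (act (p ◅◅ inj₁ a ◅ reverse q) x₀)                ≡⟨ cong (act q) eq ⟩
      act q x₀                                                ∎)
      where open ≡-Reasoning

  -- `R` is an invariant linking the current vertex to the current value. Closure is asked only
  -- between consecutive positions of `w`, so `R` may speak of the vertices of a cycle alone.
  act-preserves : (R : Vertex G → Fin n → Set) →
    ∀ {u v} (w : Walk u v) →
    (∀ i {z x} (a : Adjacent G (w ! i) z) → z ≡ w ! suc i → R (w ! i) x → R z (step a x)) →
    ∀ {x} → R u x → R v (act w x)
  act-preserves R ε       closed r = r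
  act-preserves R (a ◅ w) closed r = act-preserves R w (closed ∘ suc) (closed 0 a refl r)

  module _ {u} (w : Walk u u) (irr : Irreducible w) {m} (len : length w ≡ 3 + m) where

    -- Transport along `w` follows the values of `k`. On return to `u` the value is `k` at some
    -- index of `u`, and injectivity of `vertex` makes that index `zero`.
    consistent⇒fixed : HasConsistentLabeling (cycle w irr len) (restrict (cycle⊆ w irr len) K) →
      ∃[ x ] act w x ≡ x
    consistent⇒fixed (k , consistent) = k zero , returned (act-preserves R w closed (zero , refl , refl))
      where
      v = vertex w irr len

      R : Vertex G → Fin n → Set
      R z x = ∃[ i ] (v i ≡ z × k i ≡ x)

      step-k : ∀ i j (a : Adjacent G (v i) (v j)) → step a (k i) ≡ k j
      step-k i j (inj₁ a) = decidable-stable (_ ≟ _) (consistent (edge i j a))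
      step-k i j (inj₂ a) = trans
        (cong (K (edge _ _ a) ⟨$⟩ˡ_) (sym (decidable-stable (_ ≟ _) (consistent (edge j i a)))))
        (inverseˡ (K (edge _ _ a)))

      move : ∀ {y z x j} (a : Adjacent G y z) → v j ≡ z → R y x → R z (step a x)
      move {j = j} a refl (i , refl , refl) = j , refl , sym (step-k i j a)

      closed : ∀ i {z x} (a : Adjacent G (w ! i) z) → z ≡ w ! suc i → R (w ! i) x → R z (step a x)
      closed i a refl with on-cycle w irr len (suc i)
      ... | j , vj≡ = move {j = j} a vj≡

      returned : R u (act w (k zero)) → act w (k zero) ≡ k zero
      returned (i , vi≡u , ki≡) = trans (sym ki≡) (cong k (vertex-injective w irr len vi≡u))

-- Labels from `L_n` on a bipartite graph.

module Reflections (G : Graph) (bipartite : Bipartite G) {n : ℕ} .{{_ : NonZero n}}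
  (K : EdgeLabeling G n) (inL : ∀ e → InL (K e)) where
  open Walks G
  open Action G K

  side : Vertex G → Bool
  side = proj₁ bipartite

  -- A reflection keeps argument plus image constant modulo `n`. This relation is symmetric in the
  -- two, so traversing an edge backwards has the same constant.
  step-sum : ∀ {u v} (a : Adjacent G u v) x y → toℕ (step a x) + toℕ x ≡ₙ toℕ (step a y) + toℕ y
  step-sum a x y = trans (sum≡index a x) (sym (sum≡index a y))
    where
    index : ∀ {u v} → Adjacent G u v → Fin n
    index (inj₁ a) = proj₁ (inL (edge _ _ a))
    index (inj₂ a) = proj₁ (inL (edge _ _ a))

    sum≡index : ∀ {u v} (a : Adjacent G u v) x → (toℕ (step a x) + toℕ x) % n ≡ toℕ (index a)
    sum≡index (inj₁ a) x = trans
      (cong (λ t → (toℕ t + toℕ x) % n) (proj₂ (inL (edge _ _ a)) x))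
      (reflect-sum (index (inj₁ a)) x)
    sum≡index (inj₂ a) x = begin
      (toℕ s + toℕ x) % n              ≡⟨ cong (λ t → (toℕ s + toℕ t) % n) (inverseʳ ρ) ⟨
      (toℕ s + toℕ (ρ ⟨$⟩ʳ s)) % n     ≡⟨ cong (λ t → (toℕ s + toℕ t) % n) (proj₂ (inL (edge _ _ a)) s) ⟩
      (toℕ s + toℕ (reflect i s)) % n  ≡⟨ cong (_% n) (+-comm (toℕ s) _) ⟩
      (toℕ (reflect i s) + toℕ s) % n  ≡⟨ reflect-sum i s ⟩
      toℕ i                            ∎
      where
      open ≡-Reasoning
      ρ = K (edge _ _ a)
      i = index (inj₂ a)
      s = step (inj₂ a) x

  private
    regroupˡ : ∀ p y s t → p + y + (s + t) ≡ p + s + (t + y)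
    regroupˡ = solve-∀

    regroupʳ : ∀ p x s t → p + x + (s + t) ≡ p + t + (s + x)
    regroupʳ = solve-∀

  -- A walk acts as a translation or as a reflection according to whether its
  -- ends lie on the same side; both sides are moved so that nothing is subtracted.
  act-even : ∀ {u v} (w : Walk u v) → side u ≡ side v →
    ∀ x y → toℕ (act w x) + toℕ y ≡ₙ toℕ (act w y) + toℕ x
  act-odd : ∀ {u v} (w : Walk u v) → side u ≢ side v →
    ∀ x y → toℕ (act w x) + toℕ x ≡ₙ toℕ (act w y) + toℕ y

  act-even ε _ x y = cong (_% n) (+-comm (toℕ x) (toℕ y))
  -- Adding `s + t`, the values after the first step, lets the induction hypothesis and `step-sum`
  -- be added; then `s + t` is cancelled.
  act-even {u} {v} (_◅_ {j = u′} a w) u~v x y = +-cancelʳₙ (s + t) (begin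
    (toℕ (act w sx) + toℕ y + (s + t)) % n       ≡⟨ cong (_% n) (regroupˡ (toℕ (act w sx)) (toℕ y) s t) ⟩
    (toℕ (act w sx) + s + (t + toℕ y)) % n       ≡⟨ +-congₙ (act-odd w u′≁v sx sy) (step-sum a y x) ⟩
    (toℕ (act w sy) + t + (s + toℕ x)) % n       ≡⟨ cong (_% n) (regroupʳ (toℕ (act w sy)) (toℕ x) s t) ⟨
    (toℕ (act w sy) + toℕ x + (s + t)) % n       ∎)
    where
    open ≡-Reasoning
    sx = step a x
    sy = step a y
    s = toℕ sx
    t = toℕ sy

    u′≁v : side u′ ≢ side v
    u′≁v eq = proj₂ bipartite u u′ a (trans u~v (sym eq))

  act-odd ε u≁u x y = ⊥-elim (u≁u refl)
  act-odd {u} {v} (_◅_ {j = u′} a w) u≁v x y = +-cancelʳₙ (s + t) (begin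
    (toℕ (act w sx) + toℕ x + (s + t)) % n       ≡⟨ cong (_% n) (regroupʳ (toℕ (act w sx)) (toℕ x) s t) ⟩
    (toℕ (act w sx) + t + (s + toℕ x)) % n       ≡⟨ +-congₙ (act-even w u′~v sx sy) (step-sum a x y) ⟩
    (toℕ (act w sy) + s + (t + toℕ y)) % n       ≡⟨ cong (_% n) (regroupˡ (toℕ (act w sy)) (toℕ y) s t) ⟨
    (toℕ (act w sy) + toℕ y + (s + t)) % n       ∎)
    where
    open ≡-Reasoning
    sx = step a x
    sy = step a y
    s = toℕ sx
    t = toℕ sy

    u′~v : side u′ ≡ side v
    -- With only two sides, `side u′` and `side v` both equal `not (side u)`.
    u′~v = trans (¬-not (proj₂ bipartite u u′ a ∘ sym)) (sym (¬-not (u≁v ∘ sym)))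

  -- A closed walk has its ends on one side, so `act-even` makes it a translation, and a translation
  -- with a fixed point is the identity.
  fixed⇒¬bad : ∀ {u} (w : Walk u u) → ∃[ x ] act w x ≡ x → ¬ Bad w
  fixed⇒¬bad w (x , wx≡x) (y , wy≢y) = wy≢y (toℕ-injectiveₙ (+-cancelʳₙ (toℕ x) (begin
    (toℕ (act w y) + toℕ x) % n  ≡⟨ act-even w refl y x ⟩
    (toℕ (act w x) + toℕ y) % n  ≡⟨ cong (λ t → (toℕ t + toℕ y) % n) wx≡x ⟩
    (toℕ x + toℕ y) % n          ≡⟨ cong (_% n) (+-comm (toℕ x) (toℕ y)) ⟩
    (toℕ y + toℕ x) % n          ∎)))
    where open ≡-Reasoning

-- Both directions of the equivalence.

theorem9 : ∀ (n : ℕ) .{{_ : NonZero n}} (G : Graph) → Bipartite G →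
    (K : EdgeLabeling G n) → (∀ e → InL (K e)) →
    (¬ HasConsistentLabeling G K) ⇔
    (∃[ C ] Σ[ ι ∈ C ⊆ G ]
    (IsCycle C × Chordless ι × ¬ HasConsistentLabeling C (restrict ι K)))
theorem9 n G bipartite K inL = mk⇔ to from
  where
  open InducedCycle G
  open Action G K
  open Reflections G bipartite K inL

  from : (∃[ C ] Σ[ ι ∈ C ⊆ G ]
    (IsCycle C × Chordless ι × ¬ HasConsistentLabeling C (restrict ι K))) →
    ¬ HasConsistentLabeling G K
  from (C , ι , _ , _ , none) (k , consistent) = none (k ∘ incl ι , consistent ∘ inclᴱ ι)

  to : ¬ HasConsistentLabeling G K → ∃[ C ] Σ[ ι ∈ C ⊆ G ]
    (IsCycle C × Chordless ι × ¬ HasConsistentLabeling C (restrict ι K))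
  to none with consistent-or-bad origin
  ... | inj₁ has = ⊥-elim (none has)
  ... | inj₂ (_ , w₀ , bad₀) with irreducible-bad w₀ (<-wellFounded _) bad₀
  ...   | _ , w , bad , irr with bad-long w bad
  ...     | m , len = cycle w irr len , cycle⊆ w irr len , cycle-isCycle w irr len , (λ _ _ a → a) ,
            λ has → fixed⇒¬bad w (consistent⇒fixed w irr len has) bad
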